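{- Let $G$ be a finite simple graph with maximum degree at most $4$ such that no connected component of $G$ is isomorphic to $C_{2,5}$. Then $\nu_s(G)\geq \frac{1}{9}\bigl(n(G)-i(G)\bigr)$, where $n(G)$ is the number of vertices of $G$ and $i(G)$ is the number of isolated vertices of $G$.
   Context: An induced matching of a graph $G=(V,E)$ is a set $M\subseteq E$ of edges such that every vertex of $G$ is incident to at most one edge of $M$ and, whenever $ab,cd\in M$ are distinct, none of $ac,ad,bc,bd$ belongs to $E$. The strong matching number $\nu_s(G)$ is the maximum size of an induced matching of $G$. The graph $C_{2,5}$ is obtained from the $5$-cycle $C_5$ by replacing each vertex by two non-adjacent vertices: its vertex set is $\{(i,j): i\in \mathbb{Z}_5,\ j\in\{1,2\}\}$, and $(i,j)$ is adjacent to $(i',j')$ if and only if $i'-i\equiv \pm 1 \pmod 5$. -}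

module Defs where

open import Data.Nat using (ℕ; zero; suc; _+_; _*_; _∸_; _≤_; _%_)
open import Data.Fin using (Fin; toℕ)
open import Data.Bool using (Bool; true; false; if_then_else_)
open import Data.List using (List; map; allFin)
open import Data.Nat.ListAction using (sum)
open import Data.Product using (_×_; _,_; Σ; ∃; ∃-syntax)
open import Data.Sum using (_⊎_)
open import Relation.Binary.PropositionalEquality using (_≡_; _≢_)
open import Relation.Nullary using (¬_)
open import Function.Bundles using (_⇔_)

record SimpleGraph (n : ℕ) : Set where
  field
    adj   : Fin n → Fin n → Bool
    sym   : ∀ u v → adj u v ≡ adj v u
    irrefl : ∀ v → adj v v ≡ false
open SimpleGraph public

Adj : ∀ {n} → SimpleGraph n → Fin n → Fin n → Set
Adj G u v = adj G u v ≡ true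

indicator : Bool → ℕ
indicator b = if b then 1 else 0

degree : ∀ {n} → SimpleGraph n → Fin n → ℕ
degree {n} G v = sum (map (λ u → indicator (adj G v u)) (allFin n))

isIsolatedᵇ : ℕ → Bool
isIsolatedᵇ zero = true
isIsolatedᵇ (suc _) = false

isolatedCount : ∀ {n} → SimpleGraph n → ℕ
isolatedCount {n} G = sum (map (λ v → indicator (isIsolatedᵇ (degree G v))) (allFin n))

MaxDegreeAtMost : ∀ {n} → SimpleGraph n → ℕ → Set
MaxDegreeAtMost G d = ∀ v → degree G v ≤ d

record InducedMatching {n} (G : SimpleGraph n) (k : ℕ) : Set where
  field
    edge    : Fin k → Fin n × Fin n
    isEdge  : ∀ i → let (a , b) = edge i in Adj G a b
    disjoint : ∀ i j → i ≢ j →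
      let (a , b) = edge i in let (c , d) = edge j in
      (a ≢ c) × (a ≢ d) × (b ≢ c) × (b ≢ d)
    induced : ∀ i j → i ≢ j →
      let (a , b) = edge i in let (c , d) = edge j in
      ¬ Adj G a c × ¬ Adj G a d × ¬ Adj G b c × ¬ Adj G b d

-- ν_s(G) ≥ m  (m a natural number, expressed as existence of an induced matching)
-- We state ν_s(G) ≥ (n - i)/9 as: ∃ k, InducedMatching G k × n - i ≤ 9 k.
StrongMatchingAtLeastNinth : ∀ {n} → SimpleGraph n → Set
StrongMatchingAtLeastNinth {n} G =
  ∃[ k ] (InducedMatching G k × (n ∸ isolatedCount G ≤ 9 * k))

data Reachable {n} (G : SimpleGraph n) : Fin n → Fin n → Set where
  here  : ∀ {v} → Reachable G v v
  step  : ∀ {u v w} → Reachable G u v → Adj G v w → Reachable G u w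

C25V : Set
C25V = Fin 5 × Fin 2

C25Adj : C25V → C25V → Set
C25Adj (i , _) (i' , _) =
  (toℕ i' ≡ (toℕ i + 1) % 5) ⊎ (toℕ i ≡ (toℕ i' + 1) % 5)

ComponentIsoC25 : ∀ {n} → SimpleGraph n → Fin n → Set
ComponentIsoC25 {n} G v =
  Σ (C25V → Fin n) λ f →
    (∀ x y → f x ≡ f y → x ≡ y) ×
    (∀ x → Reachable G v (f x)) ×
    (∀ u → Reachable G v u → ∃[ x ] f x ≡ u) ×
    (∀ x y → Adj G (f x) (f y) ⇔ C25Adj x y)

NoComponentIsoC25 : ∀ {n} → SimpleGraph n → Set
NoComponentIsoC25 {n} G = ∀ (v : Fin n) → ¬ ComponentIsoC25 G v

{-# OPTIONS --safe #-}
-- Call an edge uv good if deleting N[u] ∪ N[v] removes at most 9 non-isolated vertices, counting those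
-- that become isolated.  Every graph with an edge, maximum degree at most 4 and no C₂,₅ component has a
-- good edge; adding it to an induced matching of the remaining graph proves the bound by induction.
-- If an edge is not good, then at least 10 − |N[u] ∪ N[v]| ≥ 2 further vertices have all their
-- neighbours in N[u] ∪ N[v].  This forces the graph around a vertex of minimum degree so strongly that
-- a finite search over the possible neighbourhoods ends, in every branch, in a contradiction or in C₂,₅.
module Submission where

open import Defs
open import Data.Bool using (Bool; true; false; T; T?; not; _∧_; _∨_; if_then_else_)
open import Data.Bool.ListAction using (any; all)
open import Data.Bool.Properties using (T-≡; T-∧; T-∨; ∧-comm) renaming (_≟_ to _≟ᵇ_)
open import Data.Fin using (Fin; zero; suc; toℕ)
open import Data.Fin.Properties using (any?) renaming (_≟_ to _≟ᶠ_)
open import Data.List using (List; []; _∷_; _++_; map; filter; filterᵇ; findᵇ; concatMap; cartesianProduct; length; allFin)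
open import Data.List.Membership.Propositional using (_∈_; _∉_; lose; find)
open import Data.List.Membership.Propositional.Properties
open import Data.List.Properties using (length-map; length-++; length-tabulate; map-++)
open import Data.List.Relation.Unary.All as All using (All; []; _∷_)
open import Data.List.Relation.Unary.All.Properties as AllP using (all⁺; all⁻; ¬Any⇒All¬)
open import Data.List.Relation.Unary.AllPairs using ([]; _∷_)
open import Data.List.Relation.Unary.Any as Any using (Any; here; there)
open import Data.List.Relation.Unary.Any.Properties as AnyP using (any⁺; any⁻)
open import Data.List.Relation.Unary.Unique.Propositional using (Unique)
import Data.List.Relation.Unary.Unique.Propositional.Properties as Unique
open import Data.Maybe using (Maybe; just; nothing; maybe′; is-nothing; fromMaybe)
open import Data.Vec as Vec using (Vec; []; _∷_)
open import Data.Product.Properties using (≡-dec)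
open import Data.Nat using (ℕ; zero; suc; _+_; _*_; _∸_; _≤_; _<_; _≡ᵇ_; _≤ᵇ_; _<ᵇ_; _%_; z≤n; s≤s; _≤?_)
open import Data.Nat.ListAction using (sum)
open import Data.Nat.Properties
open import Data.Product using (∃; ∃₂; ∃-syntax; _×_; _,_; proj₁; proj₂)
open import Data.Sum using (_⊎_; inj₁; inj₂)
open import Function using (_∘_; id; const)
open import Function.Bundles using (mk⇔; Equivalence)
open import Relation.Binary.PropositionalEquality using (_≡_; _≢_; refl; trans; cong; cong₂; subst; subst₂) renaming (sym to ≡-sym)
open import Relation.Nullary using (¬_; Dec; yes; no; does; contradiction)
open import Relation.Nullary.Decidable using (¬?; _⊎-dec_; decidable-stable; dec-true)

-- With maximum degree 4 the set N[u] ∪ N[v] has at most 8 vertices, so a budget of 9 tolerates one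
-- bystander that becomes isolated. In C₂,₅ every edge has two: with consecutive classes 0 and 1 for
-- its ends, both vertices of class 3 lose all neighbours, and ten vertices go at once. The search
-- works with partial knowledge: some vertices have complete neighbour lists, others only a number.
-- When both ends of an edge have complete lists but at most nine removed vertices are known, a
-- further one must exist, and its neighbours are confined to vertices already numbered. Such steps
-- fill in the picture without opening it further. Starting at a vertex of minimum degree δ, for δ =
-- 1, ..., 4 in turn, allows every list shorter than δ to be discarded.

private variable
  A B : Set

-- Finite lists

length-⊆ : {xs ys : List A} → Unique xs → (∀ {x} → x ∈ xs → x ∈ ys) → length xs ≤ length ys
length-⊆ [] _ = z≤n
length-⊆ {xs = x ∷ xs} (x∉ ∷ u) sub with ∈-∃++ (sub (here refl))
... | as , bs , refl = begin
  suc (length xs)             ≤⟨ s≤s (length-⊆ u sub′) ⟩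
  suc (length (as ++ bs))     ≡⟨ cong suc (length-++ as) ⟩
  suc (length as + length bs) ≡⟨ +-suc (length as) (length bs) ⟨
  length as + length (x ∷ bs) ≡⟨ length-++ as ⟨
  length (as ++ x ∷ bs)       ∎
  where
  open ≤-Reasoning
  sub′ : ∀ {y} → y ∈ xs → y ∈ as ++ bs
  sub′ y∈ with ∈-++⁻ as (sub (there y∈))
  ... | inj₁ y∈as = ∈-++⁺ˡ y∈as
  ... | inj₂ (here refl) = contradiction refl (All.lookup x∉ y∈)
  ... | inj₂ (there y∈bs) = ∈-++⁺ʳ as y∈bs

∃-∉ : ∀ {n} {xs ys : List (Fin n)} → Unique xs → length ys < length xs → ∃[ x ] x ∈ xs × x ∉ ys
∃-∉ {xs = xs} {ys} u len with Any.any? (λ x → ¬? (Any.any? (x ≟ᶠ_) ys)) xs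
... | yes p = find p
... | no ¬p = contradiction (length-⊆ u λ {x} x∈ → decidable-stable (Any.any? (x ≟ᶠ_) ys) λ x∉ → ¬p (lose x∈ x∉)) (<⇒≱ len)

-- Injectivity is asked only on `P`: a labelling of vertices is a total function on ℕ, but it is
-- injective only on the labels in use.
unique-map : ∀ {P : A → Set} {f : A → B} → (∀ {x y} → P x → P y → f x ≡ f y → x ≡ y) →
  ∀ {xs} → All P xs → Unique xs → Unique (map f xs)
unique-map inj [] [] = []
unique-map {f = f} inj {x ∷ xs} (px ∷ pxs) (x∉ ∷ u) = ¬Any⇒All¬ _ fx∉ ∷ unique-map inj pxs u
  where
  fx∉ : f x ∉ map f xs
  fx∉ fx∈ with ∈-map⁻ f fx∈
  ... | y , y∈ , eq = All.lookup x∉ y∈ (inj px (All.lookup pxs y∈) eq)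

sum-indicator : (p : A → Bool) (xs : List A) →
  sum (map (λ x → indicator (p x)) xs) ≡ length (filter (λ x → p x ≟ᵇ true) xs)
sum-indicator p [] = refl
sum-indicator p (x ∷ xs) with p x
... | true  = cong suc (sum-indicator p xs)
... | false = sum-indicator p xs

length-filter-not : (p : A → Bool) (xs : List A) →
  length (filterᵇ (not ∘ p) xs) + sum (map (λ x → indicator (p x)) xs) ≡ length xs
length-filter-not p [] = refl
length-filter-not p (x ∷ xs) with p x
... | true  = trans (+-suc _ _) (cong suc (length-filter-not p xs))
... | false = cong suc (length-filter-not p xs)

length-filter-split : (p q : A → Bool) (xs : List A) →
  length (filterᵇ p xs) ≤ length (filterᵇ (λ x → p x ∧ q x) xs) + length (filterᵇ (not ∘ q) xs)
length-filter-split p q [] = z≤n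
length-filter-split p q (x ∷ xs) with p x | q x
... | true  | true  = s≤s (length-filter-split p q xs)
... | true  | false = ≤-trans (s≤s (length-filter-split p q xs)) (≤-reflexive (≡-sym (+-suc _ _)))
... | false | true  = length-filter-split p q xs
... | false | false = ≤-trans (length-filter-split p q xs) (+-monoʳ-≤ (length (filterᵇ (λ x → p x ∧ q x) xs)) (n≤1+n _))

range : ℕ → ℕ → List ℕ
range a zero    = []
range a (suc m) = a ∷ range (suc a) m

∈-range⁺ : ∀ {a m i} → a ≤ i → i < a + m → i ∈ range a m
∈-range⁺ {a} {zero} a≤i i<a = contradiction (subst (_ <_) (+-identityʳ a) i<a) (≤⇒≯ a≤i)
∈-range⁺ {a} {suc m} {i} a≤i i< with m≤n⇒m<n∨m≡n a≤i
... | inj₁ a<i  = there (∈-range⁺ a<i (subst (i <_) (+-suc a m) i<))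
... | inj₂ refl = here refl

∈-range⁻ : ∀ {a m i} → i ∈ range a m → a ≤ i × i < a + m
∈-range⁻ {a} {suc m} (here refl) = ≤-refl , m<m+n a (s≤s z≤n)
∈-range⁻ {a} {suc m} {i} (there i∈) with ∈-range⁻ i∈
... | a<i , i< = <⇒≤ a<i , subst (i <_) (≡-sym (+-suc a m)) i<

range-unique : ∀ a m → Unique (range a m)
range-unique a zero    = []
range-unique a (suc m) = All.tabulate (λ i∈ → <⇒≢ (proj₁ (∈-range⁻ i∈))) ∷ range-unique (suc a) m

range-< : ∀ m → All (_< m) (range 0 m)
range-< m = All.tabulate (proj₂ ∘ ∈-range⁻)

length-range : ∀ a m → length (range a m) ≡ m
length-range a zero    = refl
length-range a (suc m) = cong suc (length-range (suc a) m)

infix 4 _∈ᵇ_ _⊆ᵇ_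

_∈ᵇ_ : ℕ → List ℕ → Bool
x ∈ᵇ xs = any (x ≡ᵇ_) xs

_⊆ᵇ_ : List ℕ → List ℕ → Bool
xs ⊆ᵇ ys = all (_∈ᵇ ys) xs

∈ᵇ⇒∈ : ∀ {x xs} → T (x ∈ᵇ xs) → x ∈ xs
∈ᵇ⇒∈ {x} {xs} t = Any.map (≡ᵇ⇒≡ x _) (any⁻ (x ≡ᵇ_) xs t)

∈⇒∈ᵇ : ∀ {x xs} → x ∈ xs → T (x ∈ᵇ xs)
∈⇒∈ᵇ {x} x∈ = any⁺ (x ≡ᵇ_) (Any.map (≡⇒≡ᵇ x _) x∈)

T-not : ∀ {b} → ¬ T b → T (not b)
T-not {true}  ¬t = ¬t _
T-not {false} _  = _

not-T : ∀ {b} → T (not b) → ¬ T b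
not-T {false} _ ()

findᵇ-just : (p : A → Bool) (xs : List A) {x : A} → findᵇ p xs ≡ just x → x ∈ xs × T (p x)
findᵇ-just p (y ∷ xs) eq with p y in py | eq
... | true  | refl = here refl , subst T (≡-sym py) _
... | false | eq′  with findᵇ-just p xs eq′
...   | x∈ , px = there x∈ , px

isolated⇒≱1 : ∀ {d} → T (isIsolatedᵇ d) → ¬ 1 ≤ d
isolated⇒≱1 {zero} _ ()

-- Vertex degrees

module _ {n : ℕ} (G : SimpleGraph n) where

  Adj? : ∀ u v → Dec (Adj G u v)
  Adj? u v = adj G u v ≟ᵇ true

  Adj-sym : ∀ {u v} → Adj G u v → Adj G v u
  Adj-sym {u} {v} = trans (sym G v u)

  neighbours : Fin n → List (Fin n)
  neighbours v = filter (Adj? v) (allFin n)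

  neighbours-unique : ∀ v → Unique (neighbours v)
  neighbours-unique v = Unique.filter⁺ (Adj? v) (Unique.allFin⁺ n)

  Adj⇒∈ : ∀ {v w} → Adj G v w → w ∈ neighbours v
  Adj⇒∈ {v} {w} = ∈-filter⁺ (Adj? v) (∈-allFin w)

  ∈⇒Adj : ∀ {v w} → w ∈ neighbours v → Adj G v w
  ∈⇒Adj {v} w∈ = proj₂ (∈-filter⁻ (Adj? v) {xs = allFin n} w∈)

  degree-neighbours : ∀ v → degree G v ≡ length (neighbours v)
  degree-neighbours v = sum-indicator (adj G v) (allFin n)

  length≤degree : ∀ {v xs} → Unique xs → (∀ {w} → w ∈ xs → Adj G v w) → length xs ≤ degree G v
  length≤degree {v} {xs} u sub =
    subst (length xs ≤_) (≡-sym (degree-neighbours v)) (length-⊆ u (Adj⇒∈ ∘ sub))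

  degree≤length : ∀ {v xs} → (∀ {w} → Adj G v w → w ∈ xs) → degree G v ≤ length xs
  degree≤length {v} {xs} sub =
    subst (_≤ length xs) (≡-sym (degree-neighbours v)) (length-⊆ (neighbours-unique v) (sub ∘ ∈⇒Adj))

  Adj⇒degree≥1 : ∀ {v w} → Adj G v w → 1 ≤ degree G v
  Adj⇒degree≥1 vw = length≤degree ([] ∷ []) λ { (here refl) → vw }

  degree≥1⇒Adj : ∀ {v} → 1 ≤ degree G v → ∃ (Adj G v)
  degree≥1⇒Adj {v} d with neighbours v in eq
  ... | []    = contradiction (subst (1 ≤_) (trans (degree-neighbours v) (cong length eq)) d) λ ()
  ... | w ∷ _ = w , ∈⇒Adj (subst (w ∈_) (≡-sym eq) (here refl))

  live : Fin n → Bool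
  live v = not (isIsolatedᵇ (degree G v))

  live⁺ : ∀ {v} → 1 ≤ degree G v → T (live v)
  live⁺ {v} d with degree G v | d
  ... | suc _ | _ = _

  live⁻ : ∀ {v} → T (live v) → 1 ≤ degree G v
  live⁻ {v} t with degree G v | t
  ... | suc _ | _ = s≤s z≤n

  liveCount : ℕ
  liveCount = length (filterᵇ live (allFin n))

-- Deleting the closed neighbourhood of an edge

module _ {n : ℕ} (G : SimpleGraph n) where

  -- For an edge uv this is the closed neighbourhood N[u] ∪ N[v], since each end is a neighbour of
  -- the other.
  near : Fin n → Fin n → Fin n → Bool
  near u v w = adj G u w ∨ adj G v w

  near⁻ : ∀ {u v w} → near u v w ≡ true → Adj G u w ⊎ Adj G v w
  near⁻ {u} {v} {w} eq with adj G u w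
  ... | true  = inj₁ refl
  ... | false = inj₂ eq

  far⁻ : ∀ {u v w} → near u v w ≡ false → ¬ Adj G u w × ¬ Adj G v w
  far⁻ {u} {v} {w} eq with adj G u w | adj G v w
  ... | false | false = (λ ()) , (λ ())

  -- The vertices of N[u] ∪ N[v] are kept, but isolated.
  delete : Fin n → Fin n → SimpleGraph n
  delete u v = record
    { adj    = λ a b → adj G a b ∧ (far a ∧ far b)
    ; sym    = λ a b → cong₂ _∧_ (sym G a b) (∧-comm (far a) (far b))
    ; irrefl = λ a → cong (_∧ (far a ∧ far a)) (irrefl G a)
    }
    where
    far : Fin n → Bool
    far w = not (near u v w)

  delete⁺ : ∀ {u v a b} → Adj G a b → near u v a ≡ false → near u v b ≡ false → Adj (delete u v) a b
  delete⁺ ab fa fb rewrite ab | fa | fb = refl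

  delete⁻ : ∀ {u v a b} → Adj (delete u v) a b → Adj G a b × near u v a ≡ false × near u v b ≡ false
  delete⁻ {u} {v} {a} {b} eq with adj G a b | near u v a | near u v b
  ... | true | false | false = refl , refl , refl

  -- For an edge uv this includes N[u] ∪ N[v], which `delete` isolates, so the length is the full
  -- price of choosing uv.
  removed : Fin n → Fin n → List (Fin n)
  removed u v = filterᵇ (λ w → live G w ∧ isIsolatedᵇ (degree (delete u v) w)) (allFin n)

  removed-unique : ∀ u v → Unique (removed u v)
  removed-unique u v = Unique.filter⁺ _ (Unique.allFin⁺ n)

  -- An edge from w to a vertex outside N[u] ∪ N[v] would survive the deletion, and w would not be
  -- isolated.
  removed⁻ : ∀ {u v w} → w ∈ removed u v → near u v w ≡ false →
    1 ≤ degree G w × (∀ {z} → Adj G w z → Adj G u z ⊎ Adj G v z)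
  removed⁻ {u} {v} {w} w∈ fw
    with Equivalence.to (T-∧ {live G w}) (proj₂ (∈-filter⁻ (T? ∘ _) {xs = allFin n} w∈))
  ... | lw , iw = live⁻ G lw , near-all
    where
    near-all : ∀ {z} → Adj G w z → Adj G u z ⊎ Adj G v z
    near-all {z} wz with near u v z in eq
    ... | true = near⁻ eq
    ... | false = contradiction (Adj⇒degree≥1 (delete u v) (delete⁺ wz fw eq)) (isolated⇒≱1 iw)

GoodEdge : ∀ {n} → SimpleGraph n → Set
GoodEdge G = ∃₂ λ u v → Adj G u v × length (removed G u v) ≤ 9

-- The search for a good edge

-- In a state (k , d) the vertices are numbered 0, …, k ∸ 1, and a row (x , L) of the table d says
-- that L lists exactly the neighbours of x.
Table : Set
Table = List (ℕ × List ℕ)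

State : Set
State = ℕ × Table

nbs : Table → ℕ → Maybe (List ℕ)
nbs []            x = nothing
nbs ((y , L) ∷ d) x = if x ≡ᵇ y then just L else nbs d x

back : Table → ℕ → List ℕ
back d y = map proj₁ (filterᵇ (λ r → y ∈ᵇ proj₂ r) d)

-- A vertex with four known neighbours has no others.
saturateAt : ℕ → Table → Table
saturateAt y d = if is-nothing (nbs d y) ∧ (length (back d y) ≡ᵇ 4) then (y , back d y) ∷ d else d

saturate : List ℕ → Table → Table
saturate []       d = d
saturate (y ∷ ys) d = saturate ys (saturateAt y d)

-- Only members of `L` gain a known neighbour, so only they can newly reach four. A row made by
-- saturation lists only vertices that already have rows, so one pass suffices.
addRow : Table → ℕ → List ℕ → Table
addRow d x L = saturate L ((x , L) ∷ d)

-- If i has a row, it decides whether i is a neighbour of x; otherwise both cases are listed.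
choices : (ℕ → Bool) → Table → ℕ → ℕ → List ℕ → List (List ℕ)
choices ok d x b []       = [] ∷ []
choices ok d x b (i ∷ is) =
  maybe′ (λ L → if x ∈ᵇ L then take b else skip) (if x ≡ᵇ i then skip else (skip ++ take b)) (nbs d i)
  where
  skip : List (List ℕ)
  skip = choices ok d x b is
  take : ℕ → List (List ℕ)
  take zero    = []
  take (suc c) = if ok i then map (i ∷_) (choices ok d x c is) else []

isOpen : Table → ℕ → Bool
isOpen d x = is-nothing (nbs d x)

surelyRemoved : List ℕ → Table → ℕ → Bool
surelyRemoved N d i = (i ∈ᵇ N) ∨ maybe′ (_⊆ᵇ N) false (nbs d i)

-- `surelyRemoved` undercounts while rows are missing. At most nine hits mean that the edge is good
-- or that some removed vertex is still unaccounted for. The test `x <ᵇ y` takes each edge in one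
-- direction only.
candidate : State → (ℕ × List ℕ) × (ℕ × List ℕ) → Bool
candidate (k , d) ((x , L) , (y , L′)) =
  (x <ᵇ y) ∧ ((y ∈ᵇ L) ∧ (length (filterᵇ (surelyRemoved (L ++ L′) d) (range 0 k)) ≤ᵇ 9))

-- δ bounds the degrees of the non-isolated vertices from below.
module _ (δ : ℕ) where

  -- No fresh labels are needed for neighbours of `c`, as all of them lie in `N`. The 4 is the
  -- maximum degree.
  enclosed : List ℕ → ℕ → Table → ℕ → List State
  enclosed N k d c =
    map (λ L → k , addRow d c L) (filterᵇ (λ L → δ ≤ᵇ length L) (choices (_∈ᵇ N) d c 4 (range 0 k)))

  -- If the edge with closed neighbourhood N is not good, some vertex not accounted for has all its neighbours in N.
  remove : List ℕ → State → List State
  remove N (k , d) =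
    concatMap (enclosed N k d) (filterᵇ (λ c → isOpen d c ∧ not (c ∈ᵇ N)) (range 0 k))
      ++ enclosed N (suc k) d k

  expandWith : State → ℕ → List ℕ → List State
  expandWith (k , d) x L =
    map (λ f → k + f , addRow d x (L ++ range k f))
      -- `range 0 m` ends at m - 1, so the 5 lets `f` run up to 4 minus the length of `L`.
      (filterᵇ (λ f → δ ≤ᵇ length L + f) (range 0 (5 ∸ length L)))

  expand : ℕ → State → List State
  expand x s@(k , d) = concatMap (expandWith s x) (choices (const true) d x 4 (range 0 k))

-- Recognising C₂,₅

nb : Table → ℕ → List ℕ
nb d x = fromMaybe [] (nbs d x)

-- The default values here and in `nb` are harmless: they can only spoil a guess, and `matchesAll`
-- insists that each guessed vertex has a row.
first : (ℕ → Bool) → List ℕ → ℕ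
first p xs = fromMaybe 0 (findᵇ p xs)

-- In C₂,₅ the neighbours of v on the side of u are u and its twin, whose neighbourhoods agree; any
-- other neighbour of v leads on around the 5-cycle.
walk : Table → (m : ℕ) → ℕ → ℕ → Vec ℕ m
walk d zero    u v = []
walk d (suc m) u v = u ∷ walk d m v (first (λ w → not (nb d w ⊆ᵇ nb d u)) (nb d v))

-- In C₂,₅ all neighbourhoods have four elements, so inclusion means equality, which holds only
-- between the two copies of a vertex.
twin : State → ℕ → ℕ
twin (k , d) v = first (λ w → not (w ≡ᵇ v) ∧ (nb d w ⊆ᵇ nb d v)) (range 0 k)

-- A guess, verified by isBlowup: follow the 5-cycle from vertex 0 and add the twins.
labelling : State → Vec (ℕ × ℕ) 5
labelling s@(k , d) = Vec.map (λ v → v , twin s v) (walk d 5 0 (first (const true) (nb d 0)))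

at : Vec (ℕ × ℕ) 5 → C25V → ℕ
at g (i , zero)     = proj₁ (Vec.lookup g i)
at g (i , suc zero) = proj₂ (Vec.lookup g i)

C25Adj? : ∀ p q → Dec (C25Adj p q)
C25Adj? (i , _) (j , _) = (toℕ j ≟ (toℕ i + 1) % 5) ⊎-dec (toℕ i ≟ (toℕ j + 1) % 5)

C25≟ : (p q : C25V) → Dec (p ≡ q)
C25≟ = ≡-dec _≟ᶠ_ _≟ᶠ_

C25points : List C25V
C25points = cartesianProduct (allFin 5) (allFin 2)

∈-C25points : ∀ p → p ∈ C25points
∈-C25points (i , j) = ∈-cartesianProduct⁺ (∈-allFin i) (∈-allFin j)

matches : Table → Vec (ℕ × ℕ) 5 → C25V → C25V → Bool
matches d g p q =
  does ((at g q ∈ᵇ nb d (at g p)) ≟ᵇ does (C25Adj? p q)) ∧ (does (C25≟ p q) ∨ not (at g p ≡ᵇ at g q))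

-- The inclusion of each row in the ten labels closes them under adjacency, which makes them a whole
-- component and not merely an induced copy.
matchesAll : Table → Vec (ℕ × ℕ) 5 → C25V → Bool
matchesAll d g p = not (isOpen d (at g p)) ∧
  ((nb d (at g p) ⊆ᵇ map (at g) C25points) ∧ all (matches d g p) C25points)

isBlowup : Table → Vec (ℕ × ℕ) 5 → Bool
isBlowup d g = all (matchesAll d g) C25points

-- A state with no refutation is its own child, so that the search fails on it.
finish : State → List State
finish s@(k , d) = if isBlowup d (labelling s) then [] else s ∷ []

-- The search tree

module _ (δ : ℕ) where

  -- Candidate edges come before expansion: they add at most one vertex and confine its neighbours,
  -- whereas expansion may introduce several fresh vertices.
  children : State → List State
  children s@(k , d) with findᵇ (candidate s) (cartesianProduct d d)
  ... | just ((x , L) , (y , L′)) = remove δ (L ++ L′) s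
  ... | nothing with findᵇ (isOpen d) (range 0 k)
  ...   | just x  = expand δ x s
  ...   | nothing = finish s

  search : ℕ → State → Bool
  search zero    s = false
  search (suc m) s = all (search m) (children s)

-- A vertex of minimum degree with its neighbours; nothing is assumed yet about edges among these.
start : ℕ → State
start δ = suc δ , (0 , range 1 δ) ∷ []

-- Soundness of the search

does⁻ : {P : Set} (P? : Dec P) → T (does P?) → P
does⁻ (yes p) _ = p

≡ᵇ-refl : ∀ k → (k ≡ᵇ k) ≡ true
≡ᵇ-refl k = Equivalence.to T-≡ (≡⇒≡ᵇ k k refl)

<⇒≢ᵇ : ∀ {i k} → i < k → (i ≡ᵇ k) ≡ false
<⇒≢ᵇ {i} {k} i<k with i ≡ᵇ k in eq
... | true  = contradiction (≡ᵇ⇒≡ i k (Equivalence.from T-≡ eq)) (<⇒≢ i<k)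
... | false = refl

nbs-just : ∀ d {x L} → nbs d x ≡ just L → (x , L) ∈ d
nbs-just ((y , L) ∷ d) {x} eq with x ≡ᵇ y in xy | eq
... | true  | refl = here (cong (_, L) (≡ᵇ⇒≡ x y (Equivalence.from T-≡ xy)))
... | false | eq′  = there (nbs-just d eq′)

nbs-nothing : ∀ d {x} → nbs d x ≡ nothing → All (x ≢_) (map proj₁ d)
nbs-nothing []            eq = []
nbs-nothing ((y , L) ∷ d) {x} eq with x ≡ᵇ y in xy | eq
... | false | eq′ = (λ x≡y → subst T xy (≡⇒≡ᵇ x y x≡y)) ∷ nbs-nothing d eq′

isOpen⁻ : ∀ d {x} → T (isOpen d x) → nbs d x ≡ nothing
isOpen⁻ d {x} t with nbs d x | t
... | nothing | _ = refl

extend : {A : Set} → (ℕ → A) → ℕ → A → ℕ → A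
extend φ k v i = if i ≡ᵇ k then v else φ i

extend-here : (φ : ℕ → A) (k : ℕ) (v : A) → extend φ k v k ≡ v
extend-here φ k v rewrite ≡ᵇ-refl k = refl

extend-below : (φ : ℕ → A) (k : ℕ) (v : A) {i : ℕ} → i < k → extend φ k v i ≡ φ i
extend-below φ k v i<k rewrite <⇒≢ᵇ i<k = refl

back-unique : ∀ d y → Unique (map proj₁ d) → Unique (back d y)
back-unique []            y u       = []
back-unique ((x , L) ∷ d) y (x∉ ∷ u) with y ∈ᵇ L
... | false = back-unique d y u
... | true  = All.tabulate (λ z∈ → All.lookup x∉ (back⊆ d z∈)) ∷ back-unique d y u
  where
  back⊆ : ∀ d {z} → z ∈ back d y → z ∈ map proj₁ d
  back⊆ d z∈ with ∈-map⁻ proj₁ z∈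
  ... | r , r∈ , refl = ∈-map⁺ proj₁ (proj₁ (∈-filter⁻ (T? ∘ _) {xs = d} r∈))

∈-back⁻ : ∀ d {y z} → z ∈ back d y → ∃[ L ] (z , L) ∈ d × y ∈ L
∈-back⁻ d z∈ with ∈-map⁻ proj₁ z∈
... | (_ , L) , r∈ , refl with ∈-filter⁻ (T? ∘ _) {xs = d} r∈
...   | r∈d , t = L , r∈d , ∈ᵇ⇒∈ t

module Soundness {n : ℕ} (G : SimpleGraph n) (Δ≤4 : MaxDegreeAtMost G 4) where

  open import Data.List.Membership.DecPropositional (_≟ᶠ_ {n}) using (_∈?_)

  -- Labelled partial graphs and their models in G

  record Exact (k : ℕ) (φ : ℕ → Fin n) (row : ℕ × List ℕ) : Set where
    constructor exact
    field
      bound : proj₁ row < k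
      edges : All (λ j → j < k × Adj G (φ (proj₁ row)) (φ j)) (proj₂ row)
      exhaustive : ∀ {v} → Adj G (φ (proj₁ row)) v → v ∈ map φ (proj₂ row)

  infix 4 _⊨_

  -- Values of φ beyond the labels in use are unconstrained, and adjacency between two vertices
  -- without rows is left open. Distinct `keys` make the entries of `back` distinct, so that four of
  -- them really are four neighbours.
  record _⊨_ (φ : ℕ → Fin n) (s : State) : Set where
    constructor model
    field
      injective : ∀ {i j} → i < proj₁ s → j < proj₁ s → φ i ≡ φ j → i ≡ j
      nonisolated : ∀ {i} → i < proj₁ s → 1 ≤ degree G (φ i)
      rows : All (Exact (proj₁ s) φ) (proj₂ s)
      keys : Unique (map proj₁ (proj₂ s))

  open Exact
  open _⊨_

  exact-cong : ∀ {k l φ ψ r} → k ≤ l → (∀ {i} → i < k → ψ i ≡ φ i) → Exact k φ r → Exact l ψ r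
  exact-cong {φ = φ} {ψ} {x , L} k≤l agree e = exact
    (<-≤-trans (bound e) k≤l)
    (All.map (λ (j<k , a) → <-≤-trans j<k k≤l , subst₂ (Adj G) (≡-sym (agree (bound e))) (≡-sym (agree j<k)) a) (edges e))
    λ {v} a → image (exhaustive e (subst (λ u → Adj G u v) (agree (bound e)) a))
    where
    image : ∀ {v} → v ∈ map φ L → v ∈ map ψ L
    image v∈ with ∈-map⁻ φ v∈
    ... | j , j∈ , refl = subst (_∈ map ψ L) (agree (proj₁ (All.lookup (edges e) j∈))) (∈-map⁺ ψ j∈)

  image-unique : ∀ {φ s xs} → φ ⊨ s → All (_< proj₁ s) xs → Unique xs → Unique (map φ xs)
  image-unique m = unique-map (injective m)

  ∈-image : ∀ {φ s j xs} → φ ⊨ s → All (_< proj₁ s) xs → j < proj₁ s → φ j ∈ map φ xs → j ∈ xs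
  ∈-image {φ} {xs = xs} m xs<k j<k φj∈ with ∈-map⁻ φ φj∈
  ... | i , i∈ , eq = subst (_∈ xs) (≡-sym (injective m j<k (All.lookup xs<k i∈) eq)) i∈

  add : ∀ {φ k d v} → φ ⊨ (k , d) → (∀ {i} → i < k → φ i ≢ v) → 1 ≤ degree G v → extend φ k v ⊨ (suc k , d)
  add {φ} {k} {d} {v} m fresh v≥1 = model inj non (All.map (exact-cong (n≤1+n k) (extend-below φ k v)) (rows m)) (keys m)
    where
    ψ : ℕ → Fin n
    ψ = extend φ k v
    split : ∀ {i} → i < suc k → i < k ⊎ i ≡ k
    split (s≤s i≤k) = m≤n⇒m<n∨m≡n i≤k
    inj : ∀ {i j} → i < suc k → j < suc k → ψ i ≡ ψ j → i ≡ j
    inj i< j< eq with split i< | split j<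
    ... | inj₁ i<k | inj₁ j<k = injective m i<k j<k (trans (≡-sym (extend-below φ k v i<k)) (trans eq (extend-below φ k v j<k)))
    ... | inj₁ i<k | inj₂ refl = contradiction (trans (≡-sym (extend-below φ k v i<k)) (trans eq (extend-here φ k v))) (fresh i<k)
    ... | inj₂ refl | inj₁ j<k = contradiction (trans (≡-sym (extend-below φ k v j<k)) (trans (≡-sym eq) (extend-here φ k v))) (fresh j<k)
    ... | inj₂ refl | inj₂ refl = refl
    non : ∀ {i} → i < suc k → 1 ≤ degree G (ψ i)
    non i< with split i<
    ... | inj₁ i<k = subst (λ u → 1 ≤ degree G u) (≡-sym (extend-below φ k v i<k)) (nonisolated m i<k)
    ... | inj₂ refl = subst (λ u → 1 ≤ degree G u) (≡-sym (extend-here φ k v)) v≥1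

  addAll : ∀ {φ k d} F → Unique F → (∀ {v} → v ∈ F → 1 ≤ degree G v × ∀ {i} → i < k → φ i ≢ v) → φ ⊨ (k , d) →
    ∃[ ψ ] ψ ⊨ (k + length F , d) × (∀ {i} → i < k → ψ i ≡ φ i) × map ψ (range k (length F)) ≡ F
  addAll {φ} {k} {d} [] u fresh m = φ , subst (λ l → φ ⊨ (l , d)) (≡-sym (+-identityʳ k)) m , (λ _ → refl) , refl
  addAll {φ} {k} {d} (v ∷ F) (v∉ ∷ u) fresh m
    with addAll F u fresh′ (add m (proj₂ (fresh (here refl))) (proj₁ (fresh (here refl))))
    where
    fresh′ : ∀ {w} → w ∈ F → 1 ≤ degree G w × ∀ {i} → i < suc k → extend φ k v i ≢ w
    fresh′ {w} w∈ = proj₁ (fresh (there w∈)) , new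
      where
      new : ∀ {i} → i < suc k → extend φ k v i ≢ w
      new (s≤s i≤k) eq with m≤n⇒m<n∨m≡n i≤k
      ... | inj₁ i<k = proj₂ (fresh (there w∈)) i<k (trans (≡-sym (extend-below φ k v i<k)) eq)
      ... | inj₂ refl = All.lookup v∉ w∈ (trans (≡-sym (extend-here φ k v)) eq)
  ... | ψ , m′ , agree , eq = ψ , subst (λ l → ψ ⊨ (l , d)) (≡-sym (+-suc k (length F))) m′ ,
    (λ i<k → trans (agree (m<n⇒m<1+n i<k)) (extend-below φ k v i<k)) ,
    cong₂ _∷_ (trans (agree ≤-refl) (extend-here φ k v)) eq

  cons : ∀ {φ k d x L} → φ ⊨ (k , d) → nbs d x ≡ nothing → Exact k φ (x , L) → φ ⊨ (k , (x , L) ∷ d)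
  cons {d = d} m eq e = model (injective m) (nonisolated m) (e ∷ rows m) (nbs-nothing d eq ∷ keys m)

  saturateAt-sound : ∀ {φ k d y} → y < k → φ ⊨ (k , d) → φ ⊨ (k , saturateAt y d)
  saturateAt-sound {φ} {k} {d} {y} y<k m with isOpen d y in o | length (back d y) ≡ᵇ 4 in four
  ... | false | _     = m
  ... | true  | false = m
  ... | true  | true  = cons m (isOpen⁻ d (Equivalence.from T-≡ o)) (exact y<k (All.tabulate edge) full)
    where
    edge : ∀ {j} → j ∈ back d y → j < k × Adj G (φ y) (φ j)
    edge j∈ with ∈-back⁻ d j∈
    ... | L , r∈ , y∈L = bound r , Adj-sym G (proj₂ (All.lookup (edges r) y∈L))
      where r = All.lookup (rows m) r∈
    N : List (Fin n)
    N = map φ (back d y)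
    unique : Unique N
    unique = image-unique m (All.tabulate (proj₁ ∘ edge)) (back-unique d y (keys m))
    adjacent : ∀ {w} → w ∈ N → Adj G (φ y) w
    adjacent w∈ with ∈-map⁻ φ w∈
    ... | j , j∈ , refl = proj₂ (edge j∈)
    full : ∀ {v} → Adj G (φ y) v → v ∈ N
    full {v} a with v ∈? N
    ... | yes v∈ = v∈
    ... | no v∉ = contradiction (Δ≤4 (φ y)) (<⇒≱ (subst (_≤ degree G (φ y)) (cong suc four′) five))
      where
      five : suc (length N) ≤ degree G (φ y)
      five = length≤degree G {xs = v ∷ N} (¬Any⇒All¬ _ v∉ ∷ unique) λ { (here refl) → a ; (there w∈) → adjacent w∈ }
      four′ : length N ≡ 4
      four′ = trans (length-map φ (back d y)) (≡ᵇ⇒≡ _ 4 (Equivalence.from T-≡ four))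

  saturate-sound : ∀ {φ k d ys} → All (_< k) ys → φ ⊨ (k , d) → φ ⊨ (k , saturate ys d)
  saturate-sound []           m = m
  saturate-sound (y<k ∷ ys<k) m = saturate-sound ys<k (saturateAt-sound y<k m)

  addRow-sound : ∀ {φ k d x L} → φ ⊨ (k , d) → nbs d x ≡ nothing → Exact k φ (x , L) → φ ⊨ (k , addRow d x L)
  addRow-sound m eq e = saturate-sound (All.map proj₁ (edges e)) (cons m eq e)

  row : ∀ {φ k d x L} → φ ⊨ (k , d) → nbs d x ≡ just L → Exact k φ (x , L)
  row {d = d} m eq = All.lookup (rows m) (nbs-just d eq)

  known : (ℕ → Fin n) → ℕ → List ℕ → List ℕ
  known φ x = filter (λ i → Adj? G (φ x) (φ i))

  -- Follow the decisions that G makes. A row of `i` agrees with G by symmetry, the case `i` = `x`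
  -- is settled by irreflexivity, and the length bound keeps the budget `b` from running out.
  choices-complete : ∀ {φ k d x ok} b is → φ ⊨ (k , d) → x < k → All (_< k) is →
    (∀ {i} → i < k → Adj G (φ x) (φ i) → T (ok i)) → length (known φ x is) ≤ b → known φ x is ∈ choices ok d x b is
  choices-complete b [] m x<k [] oks len = here refl
  choices-complete {φ} {k} {d} {x} {ok} b (i ∷ is) m x<k (i<k ∷ is<k) oks len
    with Adj? G (φ x) (φ i)
  choices-complete {φ} {k} {d} {x} {ok} (suc b) (i ∷ is) m x<k (i<k ∷ is<k) oks (s≤s len) | yes a
    rewrite Equivalence.to T-≡ (oks i<k a)
    with nbs d i in eq
  ... | nothing with x ≡ᵇ i in xi
  ...   | true with ≡ᵇ⇒≡ x i (Equivalence.from T-≡ xi)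
  ...     | refl = contradiction (trans (≡-sym a) (irrefl G (φ x))) λ ()
  choices-complete (suc b) (i ∷ is) m x<k (i<k ∷ is<k) oks (s≤s len) | yes a | nothing | false =
    ∈-++⁺ʳ _ (∈-map⁺ (i ∷_) (choices-complete b is m x<k is<k oks len))
  choices-complete {φ} {k} {d} {x} (suc b) (i ∷ is) m x<k (i<k ∷ is<k) oks (s≤s len) | yes a | just L
    rewrite Equivalence.to T-≡ (∈⇒∈ᵇ {x} {L} (∈-image m (All.map proj₁ (edges (row m eq))) x<k (exhaustive (row m eq) (Adj-sym G a)))) =
    ∈-map⁺ (i ∷_) (choices-complete b is m x<k is<k oks len)
  choices-complete {φ} {k} {d} {x} {ok} b (i ∷ is) m x<k (i<k ∷ is<k) oks len | no ¬a
    with nbs d i in eq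
  ... | nothing with x ≡ᵇ i
  ...   | true  = choices-complete b is m x<k is<k oks len
  ...   | false = ∈-++⁺ˡ (choices-complete b is m x<k is<k oks len)
  choices-complete {φ} {k} {d} {x} {ok} b (i ∷ is) m x<k (i<k ∷ is<k) oks len | no ¬a | just L with x ∈ᵇ L in xL
  ... | false = choices-complete b is m x<k is<k oks len
  ... | true  = contradiction (Adj-sym G (proj₂ (All.lookup (edges (row m eq)) (∈ᵇ⇒∈ (Equivalence.from T-≡ xL))))) ¬a

  open-new : ∀ {φ k d} → φ ⊨ (k , d) → nbs d k ≡ nothing
  open-new {k = k} {d} m with nbs d k in eq
  ... | nothing = refl
  ... | just _  = contradiction (bound (row m eq)) (n≮n k)

  known-unique : ∀ φ x k → Unique (known φ x (range 0 k))
  known-unique φ x k = Unique.filter⁺ _ (range-unique 0 k)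

  ∈-known⁻ : ∀ φ x k {j} → j ∈ known φ x (range 0 k) → j < k × Adj G (φ x) (φ j)
  ∈-known⁻ φ x k j∈ with ∈-filter⁻ (λ i → Adj? G (φ x) (φ i)) {xs = range 0 k} j∈
  ... | j∈range , a = proj₂ (∈-range⁻ j∈range) , a

  ∈-known⁺ : ∀ φ x k {j} → j < k → Adj G (φ x) (φ j) → j ∈ known φ x (range 0 k)
  ∈-known⁺ φ x k j<k = ∈-filter⁺ (λ i → Adj? G (φ x) (φ i)) (∈-range⁺ z≤n j<k)

  Satisfiable : State → Set
  Satisfiable s = ∃[ φ ] φ ⊨ s

  length≤4 : ∀ {φ s x L} → φ ⊨ s → Exact (proj₁ s) φ (x , L) → Unique L → length L ≤ 4
  length≤4 {φ} {x = x} {L} m e u = ≤-trans (subst (_≤ degree G (φ x)) (length-map φ L)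
    (length≤degree G (image-unique m (All.map proj₁ (edges e)) u) adjacent)) (Δ≤4 (φ x))
    where
    adjacent : ∀ {w} → w ∈ map φ L → Adj G (φ x) w
    adjacent w∈ with ∈-map⁻ φ w∈
    ... | j , j∈ , refl = proj₂ (All.lookup (edges e) j∈)

  module _ {δ : ℕ} (δ≤ : ∀ v → 1 ≤ degree G v → δ ≤ degree G v) where

    δ≤length : ∀ {φ s x L} → φ ⊨ s → Exact (proj₁ s) φ (x , L) → δ ≤ length L
    δ≤length {φ} {x = x} {L} m e = ≤-trans (δ≤ (φ x) (nonisolated m (bound e)))
      (subst (degree G (φ x) ≤_) (length-map φ L) (degree≤length G (exhaustive e)))

    enclosed-sound : ∀ {φ k d N c} → φ ⊨ (k , d) → c < k → nbs d c ≡ nothing →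
      (∀ {v} → Adj G (φ c) v → ∃[ j ] j < k × j ∈ N × φ j ≡ v) → Any Satisfiable (enclosed δ N k d c)
    enclosed-sound {φ} {k} {d} {N} {c} m c<k eq inN = lose
      (∈-map⁺ (λ L → k , addRow d c L) (∈-filter⁺ (T? ∘ _)
        (choices-complete 4 (range 0 k) m c<k (range-< k) ok (length≤4 m e (known-unique φ c k)))
        (≤⇒≤ᵇ (δ≤length m e))))
      (φ , addRow-sound m eq e)
      where
      ok : ∀ {i} → i < k → Adj G (φ c) (φ i) → T (i ∈ᵇ N)
      ok i<k a with inN a
      ... | j , j<k , j∈N , φj≡φi = ∈⇒∈ᵇ (subst (_∈ N) (injective m j<k i<k φj≡φi) j∈N)
      e : Exact k φ (c , known φ c (range 0 k))
      e = exact c<k (All.tabulate (∈-known⁻ φ c k)) full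
        where
        full : ∀ {v} → Adj G (φ c) v → v ∈ map φ (known φ c (range 0 k))
        full a with inN a
        ... | j , j<k , _ , refl = ∈-map⁺ φ (∈-known⁺ φ c k j<k a)

    -- If the edge is not good, more than nine vertices are removed while `S` covers at most nine,
    -- so some removed `w` is missed. As `S` contains `N`, `w` lies outside N[u] ∪ N[v] and all its
    -- neighbours are in `N`. It is new, or numbered without a row; with a row it would belong to
    -- `S`.
    remove-sound : ∀ {φ k d x y L L′} → φ ⊨ (k , d) → (x , L) ∈ d → (y , L′) ∈ d → y ∈ L →
      length (filterᵇ (surelyRemoved (L ++ L′) d) (range 0 k)) ≤ 9 →
      GoodEdge G ⊎ Any Satisfiable (remove δ (L ++ L′) (k , d))
    remove-sound {φ} {k} {d} {x} {y} {L} {L′} m x∈ y∈ y∈L few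
      with length (removed G (φ x) (φ y)) ≤? 9
    ... | yes good = inj₁ (φ x , φ y , proj₂ (All.lookup (edges (All.lookup (rows m) x∈)) y∈L) , good)
    ... | no ¬good = inj₂ (extra (∃-∉ (removed-unique G (φ x) (φ y)) (≤-<-trans few′ (≰⇒> ¬good))))
      where
      N : List ℕ
      N = L ++ L′
      S : List ℕ
      S = filterᵇ (surelyRemoved N d) (range 0 k)
      few′ : length (map φ S) ≤ 9
      few′ = subst (_≤ 9) (≡-sym (length-map φ S)) few
      inS : ∀ {j} → j < k → T (surelyRemoved N d j) → φ j ∈ map φ S
      inS j<k t = ∈-map⁺ φ (∈-filter⁺ (T? ∘ _) (∈-range⁺ z≤n j<k) t)
      N⊆S : ∀ {j} → j < k → j ∈ N → φ j ∈ map φ S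
      N⊆S j<k j∈N = inS j<k (Equivalence.from T-∨ (inj₁ (∈⇒∈ᵇ j∈N)))
      inN : ∀ {z} → Adj G (φ x) z ⊎ Adj G (φ y) z → ∃[ j ] j < k × j ∈ N × φ j ≡ z
      inN (inj₁ a) with ∈-map⁻ φ (exhaustive (All.lookup (rows m) x∈) a)
      ... | j , j∈L , refl = j , proj₁ (All.lookup (edges (All.lookup (rows m) x∈)) j∈L) , ∈-++⁺ˡ j∈L , refl
      inN (inj₂ a) with ∈-map⁻ φ (exhaustive (All.lookup (rows m) y∈) a)
      ... | j , j∈L , refl = j , proj₁ (All.lookup (edges (All.lookup (rows m) y∈)) j∈L) , ∈-++⁺ʳ L j∈L , refl
      extra : (∃[ w ] w ∈ removed G (φ x) (φ y) × w ∉ map φ S) → Any Satisfiable (remove δ N (k , d))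
      extra (w , w∈ , w∉S) with near G (φ x) (φ y) w in eqw
      ... | true with inN (near⁻ G eqw)
      ...   | j , j<k , j∈N , refl = contradiction (N⊆S j<k j∈N) w∉S
      extra (w , w∈ , w∉S) | false with removed⁻ G w∈ eqw | w ∈? map φ (range 0 k)
      ... | w≥1 , nearby | no w∉ = AnyP.++⁺ʳ _
        (enclosed-sound (add m fresh w≥1) ≤-refl (open-new m) enclosing)
        where
        fresh : ∀ {i} → i < k → φ i ≢ w
        fresh i<k refl = w∉ (∈-map⁺ φ (∈-range⁺ z≤n i<k))
        enclosing : ∀ {z} → Adj G (extend φ k w k) z → ∃[ j ] j < suc k × j ∈ N × extend φ k w j ≡ z
        enclosing {z} a with inN (nearby (subst (λ u → Adj G u z) (extend-here φ k w) a))
        ... | j , j<k , j∈N , eq = j , m<n⇒m<1+n j<k , j∈N , trans (extend-below φ k w j<k) eq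
      ... | w≥1 , nearby | yes w∈φ with ∈-map⁻ φ w∈φ
      ...   | c , c∈ , refl with proj₂ (∈-range⁻ c∈) | nbs d c in eqc
      ...     | c<k | nothing = AnyP.++⁺ˡ (AnyP.concatMap⁺ (enclosed δ N k d) (lose
        (∈-filter⁺ (T? ∘ _) c∈ (Equivalence.from T-∧ (subst (T ∘ is-nothing) (≡-sym eqc) _ ,
          T-not λ t → w∉S (N⊆S c<k (∈ᵇ⇒∈ t)))))
        (enclosed-sound m c<k eqc (inN ∘ nearby))))
      ...     | c<k | just Lc = contradiction (inS c<k sure) w∉S
        where
        inside : ∀ {j} → j ∈ Lc → T (j ∈ᵇ N)
        inside {j} j∈ with All.lookup (edges (row m eqc)) j∈
        ... | j<k , a with inN (nearby a)
        ...   | i , i<k , i∈N , eq = ∈⇒∈ᵇ (subst (_∈ N) (injective m i<k j<k eq) i∈N)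
        sure : T (surelyRemoved N d c)
        sure = Equivalence.from (T-∨ {c ∈ᵇ N}) (inj₂ (subst (T ∘ maybe′ (_⊆ᵇ N) false) (≡-sym eqc)
          (all⁻ (_∈ᵇ N) (All.tabulate inside))))

    -- Numbered neighbours are covered by `choices`. The others, `F`, may be numbered from `k` on in
    -- any order, so one child for each count `f` is enough.
    expand-sound : ∀ {φ k d x} → φ ⊨ (k , d) → x < k → nbs d x ≡ nothing → Any Satisfiable (expand δ x (k , d))
    expand-sound {φ} {k} {d} {x} m x<k eq with addAll F F-unique F-fresh m
      where
      outside? : ∀ v → Dec (v ∉ map φ (range 0 k))
      outside? v = ¬? (v ∈? map φ (range 0 k))
      F : List (Fin n)
      F = filter outside? (neighbours G (φ x))
      F-unique : Unique F
      F-unique = Unique.filter⁺ outside? (neighbours-unique G (φ x))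
      F-fresh : ∀ {v} → v ∈ F → 1 ≤ degree G v × ∀ {i} → i < k → φ i ≢ v
      F-fresh v∈ with ∈-filter⁻ outside? {xs = neighbours G (φ x)} v∈
      ... | v∈N , v∉ = Adj⇒degree≥1 G (Adj-sym G (∈⇒Adj G v∈N)) , λ { i<k refl → v∉ (∈-map⁺ φ (∈-range⁺ z≤n i<k)) }
    ... | ψ , m′ , agree , ψF = AnyP.concatMap⁺ (expandWith δ (k , d) x) (lose
      (choices-complete 4 (range 0 k) m x<k (range-< k) (λ _ _ → _) (≤-trans (m≤m+n _ f) S+f≤4))
      (lose (∈-map⁺ (λ f → k + f , addRow d x (S ++ range k f)) (∈-filter⁺ (T? ∘ _)
          (∈-range⁺ z≤n (m+n≤o⇒m≤o∸n (suc f) (s≤s (subst (_≤ 4) (+-comm (length S) f) S+f≤4))))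
          (≤⇒≤ᵇ (subst (δ ≤_) length-L (δ≤length m′ e)))))
        (ψ , addRow-sound m′ eq e)))
      where
      F : List (Fin n)
      F = filter (λ v → ¬? (v ∈? map φ (range 0 k))) (neighbours G (φ x))
      f : ℕ
      f = length F
      S : List ℕ
      S = known φ x (range 0 k)
      ψF⁻ : ∀ {j} → j ∈ range k f → Adj G (φ x) (ψ j)
      ψF⁻ j∈ = ∈⇒Adj G (proj₁ (∈-filter⁻ _ {xs = neighbours G (φ x)} (subst (_ ∈_) ψF (∈-map⁺ ψ j∈))))
      new : ∀ {j} → j ∈ range k f → j < k + f × Adj G (ψ x) (ψ j)
      new j∈ = proj₂ (∈-range⁻ j∈) , subst (λ u → Adj G u _) (≡-sym (agree x<k)) (ψF⁻ j∈)
      old : ∀ {j} → j ∈ S → j < k + f × Adj G (ψ x) (ψ j)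
      old j∈ with ∈-known⁻ φ x k j∈
      ... | j<k , a = <-≤-trans j<k (m≤m+n k f) , subst₂ (Adj G) (≡-sym (agree x<k)) (≡-sym (agree j<k)) a
      full : ∀ {v} → Adj G (ψ x) v → v ∈ map ψ (S ++ range k f)
      full {v} a with subst (λ u → Adj G u v) (agree x<k) a | v ∈? map φ (range 0 k)
      ... | a′ | no v∉ = subst (v ∈_) (≡-sym (map-++ ψ S (range k f)))
        (∈-++⁺ʳ (map ψ S) (subst (v ∈_) (≡-sym ψF) (∈-filter⁺ _ (Adj⇒∈ G a′) v∉)))
      ... | a′ | yes v∈ with ∈-map⁻ φ v∈
      ...   | j , j∈ , refl with proj₂ (∈-range⁻ j∈)
      ...     | j<k = subst (_∈ map ψ (S ++ range k f)) (agree j<k) (∈-map⁺ ψ (∈-++⁺ˡ (∈-known⁺ φ x k j<k a′)))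
      e : Exact (k + f) ψ (x , S ++ range k f)
      e = exact (<-≤-trans x<k (m≤m+n k f)) (AllP.++⁺ (All.tabulate old) (All.tabulate new)) full
      length-L : length (S ++ range k f) ≡ length S + f
      length-L = trans (length-++ S) (cong (length S +_) (length-range k f))
      S+f≤4 : length S + f ≤ 4
      S+f≤4 = subst (_≤ 4) length-L (length≤4 m′ e (Unique.++⁺ (known-unique φ x k) (range-unique k f)
        λ (j∈S , j∈R) → <⇒≱ (proj₁ (∈-known⁻ φ x k j∈S)) (proj₁ (∈-range⁻ j∈R))))

  -- Soundness of the recognition of C₂,₅

  Labels : Table → Vec (ℕ × ℕ) 5 → Set
  Labels d g = ∀ p → T (not (isOpen d (at g p))) ×
    (∀ {j} → j ∈ nb d (at g p) → j ∈ map (at g) C25points) × (∀ q → T (matches d g p q))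

  isBlowup⇒Labels : ∀ {d g} → T (isBlowup d g) → Labels d g
  isBlowup⇒Labels {d} {g} t p =
    let done , rest = Equivalence.to (T-∧ {not (isOpen d (at g p))})
          (All.lookup (all⁺ (matchesAll d g) C25points t) (∈-C25points p))
        closed , matching = Equivalence.to (T-∧ {nb d (at g p) ⊆ᵇ map (at g) C25points}) rest
    in done ,
       (λ {j} j∈ → ∈ᵇ⇒∈ {j} {map (at g) C25points}
         (All.lookup (all⁺ (_∈ᵇ map (at g) C25points) (nb d (at g p)) closed) j∈)) ,
       (λ q → All.lookup (all⁺ (matches d g p) C25points matching) (∈-C25points q))

  Labels⇒C25 : ∀ {φ k d g} → φ ⊨ (k , d) → Labels d g → ComponentIsoC25 G (φ (at g (zero , zero)))
  Labels⇒C25 {φ} {k} {d} {g} m checked = f , f-injective , reachable , onto , λ p q → mk⇔ (iso⁺ p q) (iso⁻ p q)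
    where
    f : C25V → Fin n
    f p = φ (at g p)
    exactAt : ∀ p → Exact k φ (at g p , nb d (at g p))
    exactAt p with nbs d (at g p) in eq | proj₁ (checked p)
    ... | just L | _ = row m eq
    matchesAt : ∀ p q → ((at g q ∈ᵇ nb d (at g p)) ≡ does (C25Adj? p q)) × (f p ≡ f q → p ≡ q)
    matchesAt p q with (at g q ∈ᵇ nb d (at g p)) ≟ᵇ does (C25Adj? p q) | C25≟ p q | proj₂ (proj₂ (checked p)) q
    ... | yes eq | yes p≡q | _ = eq , λ _ → p≡q
    ... | yes eq | no _    | t′ = eq , λ fp≡fq → contradiction
      (≡⇒≡ᵇ _ _ (injective m (bound (exactAt p)) (bound (exactAt q)) fp≡fq)) (not-T t′)
    f-injective : ∀ p q → f p ≡ f q → p ≡ q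
    f-injective p q = proj₂ (matchesAt p q)
    iso⁺ : ∀ p q → Adj G (f p) (f q) → C25Adj p q
    iso⁺ p q a = does⁻ (C25Adj? p q) (subst T (proj₁ (matchesAt p q)) (∈⇒∈ᵇ {xs = nb d (at g p)}
      (∈-image m (All.map proj₁ (edges (exactAt p))) (bound (exactAt q)) (exhaustive (exactAt p) a))))
    iso⁻ : ∀ p q → C25Adj p q → Adj G (f p) (f q)
    iso⁻ p q a = proj₂ (All.lookup (edges (exactAt p)) (∈ᵇ⇒∈
      (subst T (≡-sym (trans (proj₁ (matchesAt p q)) (dec-true (C25Adj? p q) a))) _)))
    neighbour : ∀ p {v} → Adj G (f p) v → ∃[ q ] f q ≡ v
    neighbour p a with ∈-map⁻ φ (exhaustive (exactAt p) a)
    ... | j , j∈ , refl with ∈-map⁻ (at g) {xs = C25points} (proj₁ (proj₂ (checked p)) j∈)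
    ...   | q , _ , refl = q , refl
    v₀ : Fin n
    v₀ = f (zero , zero)
    onto : ∀ u → Reachable G v₀ u → ∃[ q ] f q ≡ u
    onto _ here = (zero , zero) , refl
    onto _ (step r a) with onto _ r
    ... | p , refl = neighbour p a
    reach₁ : ∀ j → Reachable G v₀ (f (suc zero , j))
    reach₁ j = step here (iso⁻ (zero , zero) (suc zero , j) (inj₁ refl))
    reach₂ : ∀ j → Reachable G v₀ (f (suc (suc zero) , j))
    reach₂ j = step (reach₁ zero) (iso⁻ (suc zero , zero) (suc (suc zero) , j) (inj₁ refl))
    reach₃ : ∀ j → Reachable G v₀ (f (suc (suc (suc zero)) , j))
    reach₃ j = step (reach₂ zero) (iso⁻ (suc (suc zero) , zero) (suc (suc (suc zero)) , j) (inj₁ refl))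
    reachable : ∀ p → Reachable G v₀ (f p)
    -- The two copies in class 0 are not adjacent, so the twin of the base vertex is reached through
    -- class 1.
    reachable (zero , j)                       = step (reach₁ zero) (iso⁻ (suc zero , zero) (zero , j) (inj₂ refl))
    reachable (suc zero , j)                   = reach₁ j
    reachable (suc (suc zero) , j)             = reach₂ j
    reachable (suc (suc (suc zero)) , j)       = reach₃ j
    reachable (suc (suc (suc (suc zero))) , j) =
      step (reach₃ zero) (iso⁻ (suc (suc (suc zero)) , zero) (suc (suc (suc (suc zero))) , j) (inj₁ refl))

  module _ (noC25 : NoComponentIsoC25 G) {δ : ℕ} (δ≤ : ∀ v → 1 ≤ degree G v → δ ≤ degree G v) where

    finish-sound : ∀ {φ} s → φ ⊨ s → Any Satisfiable (finish s)
    finish-sound {φ} s@(k , d) m = unless (isBlowup d (labelling s))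
      λ t → noC25 _ (Labels⇒C25 {g = labelling s} m (isBlowup⇒Labels {d} {labelling s} t))
      where
      unless : ∀ b → ¬ T b → Any Satisfiable (if b then [] else s ∷ [])
      unless true  ¬t = contradiction _ ¬t
      unless false _  = here (φ , m)

    children-sound : ∀ {φ s} → φ ⊨ s → GoodEdge G ⊎ Any Satisfiable (children δ s)
    children-sound {φ} {s@(k , d)} m with findᵇ (candidate s) (cartesianProduct d d) in eq
    ... | just ((x , L) , (y , L′)) with findᵇ-just (candidate s) (cartesianProduct d d) eq
    ...   | xy∈ , t with ∈-cartesianProduct⁻ d d xy∈ | Equivalence.to (T-∧ {y ∈ᵇ L}) (proj₂ (Equivalence.to (T-∧ {x <ᵇ y}) t))
    ...     | x∈ , y∈ | y∈L , few = remove-sound δ≤ m x∈ y∈ (∈ᵇ⇒∈ y∈L) (≤ᵇ⇒≤ _ 9 few)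
    children-sound {φ} {s@(k , d)} m | nothing with findᵇ (isOpen d) (range 0 k) in eq′
    ... | just x with findᵇ-just (isOpen d) (range 0 k) eq′
    ...   | x∈ , t = inj₂ (expand-sound δ≤ m (proj₂ (∈-range⁻ x∈)) (isOpen⁻ d t))
    children-sound {φ} {s} m | nothing | nothing = inj₂ (finish-sound s m)

    -- Without a good edge every satisfiable state has a satisfiable child, which would give a
    -- branch longer than the fuel; a successful search has no such branch.
    search-sound : ∀ fuel {s} → Satisfiable s → T (search δ fuel s) → GoodEdge G
    search-sound (suc fuel) {s} (φ , m) t with children-sound m
    ... | inj₁ good = good
    ... | inj₂ p with find p
    ...   | s′ , s′∈ , sat = search-sound fuel sat (All.lookup (all⁺ (search δ fuel) (children δ s) t) s′∈)

  start-sound : ∀ {v} → 1 ≤ degree G v → Satisfiable (start (degree G v))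
  -- At first only the label 0 is in use, so a constant labelling is injective there.
  start-sound {v} v≥1 with addAll {const v} {1} (neighbours G v) (neighbours-unique G v) fresh
    (model (λ { (s≤s z≤n) (s≤s z≤n) _ → refl }) (λ _ → v≥1) [] [])
    where
    fresh : ∀ {w} → w ∈ neighbours G v → 1 ≤ degree G w × ∀ {i} → i < 1 → v ≢ w
    fresh w∈ = Adj⇒degree≥1 G (Adj-sym G (∈⇒Adj G w∈)) ,
      λ { _ refl → contradiction (trans (≡-sym (∈⇒Adj G w∈)) (irrefl G v)) λ () }
  ... | ψ , m , agree , ψN = ψ , subst (λ e → ψ ⊨ start e) (≡-sym (degree-neighbours G v))
    (cons m refl (exact (s≤s z≤n) (All.tabulate edge) full))
    where
    N : List (Fin n)
    N = neighbours G v
    edge : ∀ {j} → j ∈ range 1 (length N) → j < suc (length N) × Adj G (ψ 0) (ψ j)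
    edge j∈ = proj₂ (∈-range⁻ j∈) , subst (λ u → Adj G u _) (≡-sym (agree (s≤s z≤n)))
      (∈⇒Adj G (subst (_ ∈_) ψN (∈-map⁺ ψ j∈)))
    full : ∀ {w} → Adj G (ψ 0) w → w ∈ map ψ (range 1 (length N))
    full {w} a = subst (w ∈_) (≡-sym ψN) (Adj⇒∈ G (subst (λ u → Adj G u w) (agree (s≤s z≤n)) a))

-- Existence of a good edge

abstract
  -- The finite case analysis itself, done by evaluation. The 20 only bounds its depth: a branch
  -- that ran out of fuel would yield `false`.
  search₁ : search 1 20 (start 1) ≡ true
  search₁ = refl

  search₂ : search 2 20 (start 2) ≡ true
  search₂ = refl

  search₃ : search 3 20 (start 3) ≡ true
  search₃ = refl

  search₄ : search 4 20 (start 4) ≡ true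
  search₄ = refl

module _ {n : ℕ} (G : SimpleGraph n) (Δ≤4 : MaxDegreeAtMost G 4) (noC25 : NoComponentIsoC25 G) where

  DegreeAbove : ℕ → Set
  DegreeAbove δ = ∀ v → 1 ≤ degree G v → δ ≤ degree G v

  -- A vertex of degree exactly δ is a model of the start state; if there is none, the lower bound
  -- on the degrees improves by one.
  raise : ∀ δ → 1 ≤ δ → search δ 20 (start δ) ≡ true → DegreeAbove δ → GoodEdge G ⊎ DegreeAbove (suc δ)
  raise δ δ≥1 found δ≤ with any? (λ v → degree G v ≟ δ)
  ... | yes (v , eq) = inj₁ (search-sound noC25 δ≤ 20
    (subst (λ e → Satisfiable (start e)) eq (start-sound (subst (1 ≤_) (≡-sym eq) δ≥1))) (Equivalence.from T-≡ found))
    where open Soundness G Δ≤4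
  ... | no none = inj₂ λ v v≥1 → ≤∧≢⇒< (δ≤ v v≥1) λ eq → none (v , ≡-sym eq)

  goodEdge : ∀ {v} → 1 ≤ degree G v → GoodEdge G
  goodEdge {v} v≥1 with raise 1 (s≤s z≤n) search₁ (λ _ → id)
  ... | inj₁ good = good
  ... | inj₂ δ≥2 with raise 2 (s≤s z≤n) search₂ δ≥2
  ...   | inj₁ good = good
  ...   | inj₂ δ≥3 with raise 3 (s≤s z≤n) search₃ δ≥3
  ...     | inj₁ good = good
  ...     | inj₂ δ≥4 with raise 4 (s≤s z≤n) search₄ δ≥4
  ...       | inj₁ good = good
  ...       | inj₂ δ≥5 = contradiction (Δ≤4 v) (<⇒≱ (δ≥5 v v≥1))

-- Induction on the number of non-isolated vertices

C25degree : ∀ p → length (filter (C25Adj? p) C25points) ≡ 4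
C25degree (zero , _) = refl
C25degree (suc zero , _) = refl
C25degree (suc (suc zero) , _) = refl
C25degree (suc (suc (suc zero)) , _) = refl
C25degree (suc (suc (suc (suc zero))) , _) = refl

C25points-unique : Unique C25points
C25points-unique = Unique.cartesianProduct⁺ (Unique.allFin⁺ 5) (Unique.allFin⁺ 2)

module _ {n : ℕ} (G : SimpleGraph n) (Δ≤4 : MaxDegreeAtMost G 4) where

  open import Data.List.Membership.DecPropositional (_≟ᶠ_ {n}) using (_∈?_)

  delete-degree : ∀ u v → MaxDegreeAtMost (delete G u v) 4
  delete-degree u v w = ≤-trans (subst (_≤ degree G w) (≡-sym (degree-neighbours (delete G u v) w))
    (length≤degree G (neighbours-unique (delete G u v) w) λ z∈ → proj₁ (delete⁻ G (∈⇒Adj (delete G u v) z∈)))) (Δ≤4 w)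

  -- C₂,₅ is 4-regular, so a component of this kind is not created by a deletion.
  delete-C25 : ∀ {u v w} → ComponentIsoC25 (delete G u v) w → ComponentIsoC25 G w
  delete-C25 {u} {v} {w} (f , inj , reach , onto , iso) =
    f , inj , reachable ∘ reach , onto′ , λ p q → mk⇔ (Equivalence.to (iso p q) ∘ kept p) (weaken ∘ Equivalence.from (iso p q))
    where
    weaken : ∀ {a b} → Adj (delete G u v) a b → Adj G a b
    weaken = proj₁ ∘ delete⁻ G
    reachable : ∀ {z} → Reachable (delete G u v) w z → Reachable G w z
    reachable here       = here
    reachable (step r a) = step (reachable r) (weaken a)
    around : C25V → List (Fin n)
    around p = map f (filter (C25Adj? p) C25points)
    around⁻ : ∀ p {z} → z ∈ around p → Adj (delete G u v) (f p) z
    around⁻ p z∈ with ∈-map⁻ f z∈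
    ... | q , q∈ , refl = Equivalence.from (iso p q) (proj₂ (∈-filter⁻ (C25Adj? p) {xs = C25points} q∈))
    kept : ∀ p {z} → Adj G (f p) z → Adj (delete G u v) (f p) z
    kept p {z} a with z ∈? around p
    ... | yes z∈ = around⁻ p z∈
    ... | no z∉  = contradiction (Δ≤4 (f p)) (<⇒≱ (subst (_≤ degree G (f p))
      (cong suc (trans (length-map f (filter (C25Adj? p) C25points)) (C25degree p)))
      (length≤degree G {xs = z ∷ around p}
        (¬Any⇒All¬ _ z∉ ∷ Unique.map⁺ (inj _ _) (Unique.filter⁺ (C25Adj? p) C25points-unique))
        λ { (here refl) → a ; (there y∈) → weaken (around⁻ p y∈) })))
    onto′ : ∀ z → Reachable G w z → ∃[ q ] f q ≡ z
    onto′ _ here = onto _ here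
    onto′ _ (step r a) with onto′ _ r
    ... | p , refl = onto _ (step (reach p) (kept p a))

module _ {n : ℕ} (G : SimpleGraph n) where

  -- No vertex gains edges, and u, being a neighbour of v, loses all of its own.
  delete-liveCount-< : ∀ {u v} → Adj G u v → liveCount (delete G u v) < liveCount G
  delete-liveCount-< {u} {v} uv = length-⊆ {xs = u ∷ filterᵇ (live (delete G u v)) (allFin n)}
    (¬Any⇒All¬ _ u∉ ∷ Unique.filter⁺ _ (Unique.allFin⁺ n))
    λ { (here refl) → ∈-filter⁺ (T? ∘ live G) (∈-allFin u) (live⁺ G (Adj⇒degree≥1 G uv)) ; (there w∈) → still w∈ }
    where
    survivor : ∀ {w} → w ∈ filterᵇ (live (delete G u v)) (allFin n) → ∃[ z ] Adj (delete G u v) w z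
    survivor w∈ = degree≥1⇒Adj (delete G u v)
      (live⁻ (delete G u v) (proj₂ (∈-filter⁻ (T? ∘ live (delete G u v)) {xs = allFin n} w∈)))
    still : ∀ {w} → w ∈ filterᵇ (live (delete G u v)) (allFin n) → w ∈ filterᵇ (live G) (allFin n)
    still {w} w∈ with survivor w∈
    ... | z , a = ∈-filter⁺ (T? ∘ live G) (∈-allFin w) (live⁺ G (Adj⇒degree≥1 G (proj₁ (delete⁻ G a))))
    u∉ : u ∉ filterᵇ (live (delete G u v)) (allFin n)
    u∉ u∈ with survivor u∈
    ... | z , a = proj₂ (far⁻ G {u} {v} (proj₁ (proj₂ (delete⁻ G a)))) (Adj-sym G uv)

  liveCount-delete : ∀ u v → liveCount G ≤ length (removed G u v) + liveCount (delete G u v)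
  liveCount-delete u v = length-filter-split (live G) (λ w → isIsolatedᵇ (degree (delete G u v) w)) (allFin n)

  far⇒≢ : ∀ {u v w} → Adj G u v → near G u v w ≡ false → u ≢ w × v ≢ w
  far⇒≢ uv fw = (λ { refl → proj₂ (far⁻ G fw) (Adj-sym G uv) }) , (λ { refl → proj₁ (far⁻ G fw) uv })

  -- Ends of edges that survive the deletion lie outside N[u] ∪ N[v], so they neither meet nor touch
  -- u and v; between such vertices G and the remaining graph have the same edges.
  extendMatching : ∀ {u v k} → Adj G u v → InducedMatching (delete G u v) k → InducedMatching G (suc k)
  extendMatching {u} {v} {k} uv M = record { edge = edge ; isEdge = isEdge ; disjoint = disjoint ; induced = induced }
    where
    module M = InducedMatching M
    far : ∀ i → near G u v (proj₁ (M.edge i)) ≡ false × near G u v (proj₂ (M.edge i)) ≡ false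
    far i = proj₂ (delete⁻ G (M.isEdge i))
    edge : Fin (suc k) → Fin n × Fin n
    edge zero    = u , v
    edge (suc i) = M.edge i
    isEdge : ∀ i → Adj G (proj₁ (edge i)) (proj₂ (edge i))
    isEdge zero    = uv
    isEdge (suc i) = proj₁ (delete⁻ G (M.isEdge i))
    Disjoint Induced : Fin n × Fin n → Fin n × Fin n → Set
    Disjoint (a , b) (c , d) = (a ≢ c) × (a ≢ d) × (b ≢ c) × (b ≢ d)
    Induced (a , b) (c , d) = ¬ Adj G a c × ¬ Adj G a d × ¬ Adj G b c × ¬ Adj G b d
    disjoint : ∀ i j → i ≢ j → Disjoint (edge i) (edge j)
    disjoint zero zero ne = contradiction refl ne
    disjoint zero (suc j) _ with far⇒≢ uv (proj₁ (far j)) | far⇒≢ uv (proj₂ (far j))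
    ... | uc , vc | ud , vd = uc , ud , vc , vd
    disjoint (suc i) zero _ with far⇒≢ uv (proj₁ (far i)) | far⇒≢ uv (proj₂ (far i))
    ... | uc , vc | ud , vd = uc ∘ ≡-sym , vc ∘ ≡-sym , ud ∘ ≡-sym , vd ∘ ≡-sym
    disjoint (suc i) (suc j) ne = M.disjoint i j (ne ∘ cong suc)
    induced : ∀ i j → i ≢ j → Induced (edge i) (edge j)
    induced zero zero ne = contradiction refl ne
    induced zero (suc j) _ with far⁻ G {u} {v} (proj₁ (far j)) | far⁻ G {u} {v} (proj₂ (far j))
    ... | uc , vc | ud , vd = uc , ud , vc , vd
    induced (suc i) zero _ with far⁻ G {u} {v} (proj₁ (far i)) | far⁻ G {u} {v} (proj₂ (far i))
    ... | uc , vc | ud , vd = uc ∘ Adj-sym G , vc ∘ Adj-sym G , ud ∘ Adj-sym G , vd ∘ Adj-sym G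
    induced (suc i) (suc j) ne with M.induced i j (ne ∘ cong suc) | far i | far j
    ... | ac , ad , bc , bd | fa , fb | fc , fd =
      (λ e → ac (delete⁺ G e fa fc)) , (λ e → ad (delete⁺ G e fa fd)) ,
      (λ e → bc (delete⁺ G e fb fc)) , (λ e → bd (delete⁺ G e fb fd))

emptyMatching : ∀ {n} (G : SimpleGraph n) → InducedMatching G 0
emptyMatching G = record { edge = λ () ; isEdge = λ () ; disjoint = λ () ; induced = λ () }

-- The vertex set stays `Fin n` under deletion, so the induction runs on a bound for the number of
-- non-isolated vertices.
inducedMatching : ∀ m {n} (G : SimpleGraph n) → MaxDegreeAtMost G 4 → NoComponentIsoC25 G → liveCount G ≤ m →
  ∃[ k ] InducedMatching G k × liveCount G ≤ 9 * k
inducedMatching m {n} G Δ≤4 noC25 bound with any? (λ v → 1 ≤? degree G v)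
... | no none = 0 , emptyMatching G , length-⊆ {ys = []} (Unique.filter⁺ _ (Unique.allFin⁺ n))
  λ {v} v∈ → contradiction (v , live⁻ G (proj₂ (∈-filter⁻ (T? ∘ live G) {xs = allFin n} v∈))) none
... | yes (_ , w≥1) with goodEdge G Δ≤4 noC25 w≥1
inducedMatching zero G Δ≤4 noC25 bound | yes _ | u , v , uv , _ =
  contradiction (<-≤-trans (delete-liveCount-< G uv) bound) λ ()
inducedMatching (suc m) G Δ≤4 noC25 bound | yes _ | u , v , uv , few
  with inducedMatching m (delete G u v) (delete-degree G Δ≤4 u v) (λ w → noC25 w ∘ delete-C25 G Δ≤4)
    (≤-pred (<-≤-trans (delete-liveCount-< G uv) bound))
... | k , M , le = suc k , extendMatching G uv M , (begin
  liveCount G                                         ≤⟨ liveCount-delete G u v ⟩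
  length (removed G u v) + liveCount (delete G u v)   ≤⟨ +-mono-≤ few le ⟩
  9 + 9 * k                                           ≡⟨ *-suc 9 k ⟨
  9 * suc k                                           ∎)
  where open ≤-Reasoning

theorem1 : ∀ (n : ℕ) (G : SimpleGraph n) → MaxDegreeAtMost G 4 → NoComponentIsoC25 G →
    StrongMatchingAtLeastNinth G
theorem1 n G Δ≤4 noC25 with inducedMatching (liveCount G) G Δ≤4 noC25 ≤-refl
... | k , M , le = k , M , subst (_≤ 9 * k) count le
  where
  count : liveCount G ≡ n ∸ isolatedCount G
  -- Isolated and non-isolated vertices together number n, so the truncated subtraction is exact.
  count = trans (≡-sym (m+n∸n≡m (liveCount G) (isolatedCount G)))
    (cong (_∸ isolatedCount G) (trans (length-filter-not (isIsolatedᵇ ∘ degree G) (allFin n)) (length-tabulate id)))
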